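{- Let $q$ be a prime power and $t\ge 2$. Assume $V(2t,q)$ has a vector space partition into $q^t+1-a$ subspaces of dimension $t$ and $m_d$ subspaces of dimension $d$ for $d=1,2,\ldots,t-1$. For each $d$ let \[ \mu_d=\max\Big(\{0,1,\ldots,m_d\}\cap\Big[0,\tfrac{q^t-1}{q^{t-d}-1}\Big)\Big). \] Then \[ a\ge\max_{\substack{d\in\{1,\ldots,t-1\}\\ x\in\{1,\ldots,\mu_d\}}}\big(x-\mathrm{R}_q(t,d,x)\big), \] where $\mathrm{R}_q(t,d,m):=m(m-1)\,\dfrac{\tfrac12(q^{2t-2d}-1)+1-q^{t-d}}{q^t-1-m(q^{t-d}-1)}$.
   Context: A vector space partition of $V(n,q)$ (the $n$-dimensional vector space over $\mathrm{GF}(q)$) is a collection of subspaces, all of positive dimension, such that every nonzero vector lies in exactly one member. -}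

module Defs where

open import Level using (Level; _⊔_)
open import Data.Nat as ℕ using (ℕ; zero; suc)
open import Data.Nat.Primality using (Prime)
open import Data.Integer as ℤ using (ℤ; +_)
open import Data.Rational as ℚ using (ℚ; _/_; ½; 0ℚ; 1ℚ)
open import Data.Fin using (Fin)
open import Data.List using (List; length; filter)
open import Data.Fin.Base using () renaming (Fin to F)
open import Data.List.Base using ()
open import Data.Vec.Functional using (Vector)
open import Data.Product using (Σ; ∃; _×_)
open import Relation.Nullary using (¬_; yes; no)
open import Relation.Binary.PropositionalEquality using (_≡_)
open import Algebra.Bundles using (CommutativeRing)
import Algebra.Properties.Monoid.Sum as MonoidSum
open import Data.List using (allFin)

IsPrimePower : ℕ → Set
IsPrimePower q = Σ ℕ λ p → Σ ℕ λ k → Prime p × (1 ℕ.≤ k) × (q ≡ p ℕ.^ k)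

record FiniteField (c ℓ : Level) (q : ℕ) : Set (Level.suc (c ⊔ ℓ)) where
  field
    ring : CommutativeRing c ℓ
  open CommutativeRing ring
  field
    0≉1       : ¬ (0# ≈ 1#)
    inverse   : ∀ x → ¬ (x ≈ 0#) → ∃ λ y → (x * y) ≈ 1#
    enum      : Fin q → Carrier
    enum-inj  : ∀ i j → enum i ≈ enum j → i ≡ j
    enum-surj : ∀ x → ∃ λ i → enum i ≈ x

module VectorSpace {c ℓ : Level} {q : ℕ} (𝔽 : FiniteField c ℓ q) (n : ℕ) where
  open FiniteField 𝔽
  open CommutativeRing ring
  open MonoidSum +-monoid using (sum)

  Vec : Set c
  Vec = Fin n → Carrier

  IsZero : Vec → Set ℓ
  IsZero v = ∀ j → v j ≈ 0#

  NonZeroVec : Vec → Set ℓ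
  NonZeroVec v = ¬ IsZero v

  lincomb : ∀ {d} → (Fin d → Carrier) → (Fin d → Vec) → Vec
  lincomb cs b j = sum (λ i → cs i * b i j)

  LinearlyIndependent : ∀ {d} → (Fin d → Vec) → Set (c ⊔ ℓ)
  LinearlyIndependent {d} b =
    ∀ (cs : Fin d → Carrier) → IsZero (lincomb cs b) → ∀ i → cs i ≈ 0#

  InSpan : ∀ {d} → Vec → (Fin d → Vec) → Set (c ⊔ ℓ)
  InSpan {d} v b = ∃ λ (cs : Fin d → Carrier) → ∀ j → v j ≈ lincomb cs b j

  record Partition : Set (c ⊔ ℓ) where
    field
      N       : ℕ
      dim     : Fin N → ℕ
      dim-pos : ∀ i → 1 ℕ.≤ dim i
      basis   : (i : Fin N) → Fin (dim i) → Vec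
      indep   : ∀ i → LinearlyIndependent (basis i)
      cover   : ∀ v → NonZeroVec v → ∃ λ i → InSpan v (basis i)
      unique  : ∀ v → NonZeroVec v → ∀ i j →
                InSpan v (basis i) → InSpan v (basis j) → i ≡ j

    count : ℕ → ℕ
    count d = length (filter (λ i → dim i ℕ.≟ d) (allFin N))

open import Data.Nat using (_*_; _∸_; _^_; _<?_)

-- μ_d = max ({0,…,m} ∩ [0, (q^t-1)/(q^(t-d)-1)) ), i.e. the largest x ≤ m
-- with x * (q^(t-d) - 1) < q^t - 1 (the set is downward closed and contains 0).
μ : (q t d m : ℕ) → ℕ
μ q t d zero = zero
μ q t d (suc m) with (suc m * (q ^ (t ∸ d) ∸ 1)) <? (q ^ t ∸ 1)
... | yes _ = suc m
... | no  _ = μ q t d m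

-- p / k for a natural k, with junk value 0 for k = 0 (never used below,
-- since the denominator of R is positive in the range of the theorem)
divℕ : ℚ → ℕ → ℚ
divℕ p zero    = 0ℚ
divℕ p (suc k) = p ℚ.* (+ 1 / suc k)

ℕ→ℚ : ℕ → ℚ
ℕ→ℚ k = + k / 1

R : (q t d m : ℕ) → ℚ
R q t d m =
  divℕ (ℕ→ℚ (m * (m ∸ 1)) ℚ.*
          ((½ ℚ.* (ℕ→ℚ (q ^ (2 * t ∸ 2 * d)) ℚ.- 1ℚ)) ℚ.+ 1ℚ ℚ.- ℕ→ℚ (q ^ (t ∸ d))))
       (q ^ t ∸ 1 ∸ m * (q ^ (t ∸ d) ∸ 1))

{-# OPTIONS --safe #-}
module Submission where

-- Write Q = qᵗ and u = qᵗ⁻ᵈ, let T be the set of the c = Q + 1 − a members of dimension t and S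
-- a set of x members of dimension d.  A nonzero functional f that annihilates exactly k of the
-- members in S ∪ T satisfies k ≤ 1 + k(k−1)/2.  An e-dimensional subspace of V(2t,q) has
-- q²ᵗ⁻ᵉ − 1 nonzero annihilators, and two distinct members span a subspace whose dimension is the
-- sum of theirs; in particular no nonzero functional annihilates two members of T.  Hence summing
-- over all f ≠ 0 gives
--   x (Qu − 1) + c (Q − 1) ≤ Q² − 1 + x(x−1)/2 · (u² − 1) + x c (u − 1),
-- which is the claimed bound after solving for a, since (u² − 1)/2 + 1 − u = (u − 1)²/2.

open import Defs
open import Level using (Level)
open import Data.Nat as ℕ using (ℕ; zero; suc; _+_; _*_; _∸_; _^_; _≤_; _<_; _<?_; z≤n; s≤s; NonZero)
import Data.Nat.Properties as ℕ
open import Data.Nat.Tactic.RingSolver using (solve-∀)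
open import Data.Integer as ℤ using (ℤ; +_)
import Data.Integer.Properties as ℤ
open import Data.Rational as ℚ using (ℚ; _/_; ½; 1ℚ; toℚᵘ)
import Data.Rational.Properties as ℚ
open import Data.Rational.Solver using (module +-*-Solver)
import Data.Rational.Unnormalised as ℚᵘ
import Data.Rational.Unnormalised.Properties as ℚᵘ
open import Data.Fin using (Fin; zero; suc; _↑ˡ_; _↑ʳ_; splitAt)
import Data.Fin.Properties as Fin
open import Data.List using (List; []; _∷_; length; map; _++_; cartesianProductWith; take; filter; allFin)
open import Data.List.Properties using (length-tabulate; length-take)
open import Data.List.Membership.Propositional using (_∈_)
open import Data.List.Membership.Propositional.Properties using (∈-allFin)
open import Data.List.Relation.Unary.All as All using (All; []; _∷_)
import Data.List.Relation.Unary.All.Properties as All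
open import Data.List.Relation.Unary.AllPairs using (AllPairs; []; _∷_)
open import Data.List.Relation.Unary.Any using (here; there)
open import Data.List.Relation.Unary.Unique.Propositional using (Unique)
open import Data.List.Relation.Unary.Unique.Propositional.Properties using (allFin⁺; take⁺; filter⁺)
open import Data.Product using (_×_; _,_; proj₁; proj₂)
open import Data.Sum using (inj₁; inj₂)
open import Data.Vec.Functional using () renaming (_∷_ to _◂_; _++_ to _⧺_)
open import Data.Vec.Functional.Properties using (lookup-++ˡ; lookup-++ʳ)
open import Function using (_∘_; id)
open import Relation.Nullary using (¬_; Dec; yes; no; contradiction)
open import Relation.Nullary.Decidable using (map′; ¬?)
open import Relation.Binary.PropositionalEquality using (_≡_; _≢_; refl; sym; trans; cong; cong₂; subst; subst₂; module ≡-Reasoning)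
open import Algebra.Bundles using (CommutativeRing)
import Algebra.Properties.Ring as RingProperties
import Algebra.Properties.Semiring.Sum as SemiringSum
import Relation.Binary.Reasoning.Setoid as SetoidReasoning

private variable
  ℓ₁ ℓ₂ ℓ₃ ℓ₄ ℓ₅ : Level
  A : Set ℓ₁
  B : Set ℓ₂
  C : Set ℓ₃
  P : Set ℓ₄
  P′ : Set ℓ₅

-- Finite sums over lists.

∑ : List A → (A → ℕ) → ℕ
∑ []       g = 0
∑ (x ∷ xs) g = g x + ∑ xs g

∑-cong : ∀ (xs : List A) {g h : A → ℕ} → (∀ x → g x ≡ h x) → ∑ xs g ≡ ∑ xs h
∑-cong []       e = refl
∑-cong (x ∷ xs) e = cong₂ _+_ (e x) (∑-cong xs e)

∑-mono : ∀ (xs : List A) {g h : A → ℕ} → (∀ x → g x ≤ h x) → ∑ xs g ≤ ∑ xs h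
∑-mono []       e = z≤n
∑-mono (x ∷ xs) e = ℕ.+-mono-≤ (e x) (∑-mono xs e)

∑-distrib-+ : ∀ (xs : List A) (g h : A → ℕ) → ∑ xs (λ x → g x + h x) ≡ ∑ xs g + ∑ xs h
∑-distrib-+ []       g h = refl
∑-distrib-+ (x ∷ xs) g h rewrite ∑-distrib-+ xs g h = interchange (g x) (h x) (∑ xs g) (∑ xs h)
  where
  interchange : ∀ a b c d → a + b + (c + d) ≡ a + c + (b + d)
  interchange = solve-∀

∑-distribˡ-* : ∀ (xs : List A) k (g : A → ℕ) → ∑ xs (λ x → k * g x) ≡ k * ∑ xs g
∑-distribˡ-* []       k g = sym (ℕ.*-zeroʳ k)
∑-distribˡ-* (x ∷ xs) k g rewrite ∑-distribˡ-* xs k g = sym (ℕ.*-distribˡ-+ k (g x) (∑ xs g))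

∑-All-const : ∀ {xs : List A} {g : A → ℕ} {k} → All (λ x → g x ≡ k) xs → ∑ xs g ≡ length xs * k
∑-All-const []       = refl
∑-All-const (e ∷ es) = cong₂ _+_ e (∑-All-const es)

∑-const : ∀ (xs : List A) k → ∑ xs (λ _ → k) ≡ length xs * k
∑-const xs k = ∑-All-const (All.universal (λ _ → refl) xs)

∑-++ : ∀ (xs ys : List A) (g : A → ℕ) → ∑ (xs ++ ys) g ≡ ∑ xs g + ∑ ys g
∑-++ []       ys g = refl
∑-++ (x ∷ xs) ys g rewrite ∑-++ xs ys g = sym (ℕ.+-assoc (g x) _ _)

∑-map : ∀ (f : A → B) (xs : List A) (g : B → ℕ) → ∑ (map f xs) g ≡ ∑ xs (λ x → g (f x))
∑-map f []       g = refl
∑-map f (x ∷ xs) g = cong (_+_ (g (f x))) (∑-map f xs g)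

∑-cartesianProductWith : ∀ (f : A → B → C) xs ys (g : C → ℕ) →
  ∑ (cartesianProductWith f xs ys) g ≡ ∑ xs λ x → ∑ ys λ y → g (f x y)
∑-cartesianProductWith f []       ys g = refl
∑-cartesianProductWith f (x ∷ xs) ys g =
  trans (∑-++ (map (f x) ys) _ g)
        (cong₂ _+_ (∑-map (f x) ys g) (∑-cartesianProductWith f xs ys g))

∑-comm : ∀ (xs : List A) (ys : List B) (g : A → B → ℕ) →
  ∑ xs (λ x → ∑ ys λ y → g x y) ≡ ∑ ys (λ y → ∑ xs λ x → g x y)
∑-comm []       ys g = sym (trans (∑-const ys 0) (ℕ.*-zeroʳ (length ys)))
∑-comm (x ∷ xs) ys g = trans (cong (_+_ (∑ ys (g x))) (∑-comm xs ys g)) (sym (∑-distrib-+ ys _ _))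

-- Indicators of decidable propositions.

⟦_⟧ : Dec P → ℕ
⟦ yes _ ⟧ = 1
⟦ no _ ⟧  = 0

⟦⟧-true : (d : Dec P) → P → ⟦ d ⟧ ≡ 1
⟦⟧-true (yes _) p = refl
⟦⟧-true (no ¬p) p = contradiction p ¬p

⟦⟧-false : (d : Dec P) → ¬ P → ⟦ d ⟧ ≡ 0
⟦⟧-false (yes p) ¬p = contradiction p ¬p
⟦⟧-false (no _)  ¬p = refl

⟦⟧-cong : (d : Dec P) (e : Dec P′) → (P → P′) → (P′ → P) → ⟦ d ⟧ ≡ ⟦ e ⟧
⟦⟧-cong (yes p) e f g = sym (⟦⟧-true e (f p))
⟦⟧-cong (no ¬p) e f g = sym (⟦⟧-false e (λ x → ¬p (g x)))

⟦⟧-× : ∀ {s} {S : Set s} (d : Dec P) (e : Dec P′) (s : Dec S) →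
  (S → P × P′) → (P → P′ → S) → ⟦ s ⟧ ≡ ⟦ d ⟧ * ⟦ e ⟧
⟦⟧-× (no ¬p) e       s f g = ⟦⟧-false s λ x → let (p , _) = f x in ¬p p
⟦⟧-× (yes p) (no ¬q) s f g = ⟦⟧-false s λ x → let (_ , q) = f x in ¬q q
⟦⟧-× (yes p) (yes q) s f g = ⟦⟧-true s (g p q)

-- Counts the solutions of a uniquely solvable equation: a duplicate-free list meets `x₀` once, and
-- every other entry contributes 0.
∑-⟦⟧-unique : ∀ {P : A → Set ℓ₄} (P? : ∀ x → Dec (P x)) {x₀} →
  P x₀ → (∀ x → P x → x ≡ x₀) → ∀ {xs} → Unique xs → x₀ ∈ xs → ∑ xs (λ x → ⟦ P? x ⟧) ≡ 1
∑-⟦⟧-unique P? px₀ uniq {x ∷ xs} (x∉xs ∷ _) (here refl) =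
  cong₂ _+_ (⟦⟧-true (P? x) px₀)
    (trans (∑-All-const (All.map (λ x≢y → ⟦⟧-false (P? _) λ py → x≢y (sym (uniq _ py))) x∉xs))
           (ℕ.*-zeroʳ (length xs)))
∑-⟦⟧-unique P? px₀ uniq {x ∷ xs} (x∉xs ∷ xs!) (there x₀∈xs) =
  cong₂ _+_ (⟦⟧-false (P? x) λ px → All.lookup x∉xs x₀∈xs (uniq x px))
    (∑-⟦⟧-unique P? px₀ uniq xs! x₀∈xs)

-- Sums over unordered pairs and the Bonferroni inequality.

∑∑ : List A → (A → A → ℕ) → ℕ
∑∑ []       g = 0
∑∑ (x ∷ xs) g = ∑ xs (g x) + ∑∑ xs g

∑∑-cong : ∀ (xs : List A) {g h : A → A → ℕ} → (∀ x y → g x y ≡ h x y) → ∑∑ xs g ≡ ∑∑ xs h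
∑∑-cong []       e = refl
∑∑-cong (x ∷ xs) e = cong₂ _+_ (∑-cong xs (e x)) (∑∑-cong xs e)

∑∑-++ : ∀ (xs ys : List A) g →
  ∑∑ (xs ++ ys) g ≡ ∑∑ xs g + ∑ xs (λ x → ∑ ys (g x)) + ∑∑ ys g
∑∑-++ []       ys g = refl
∑∑-++ (x ∷ xs) ys g rewrite ∑-++ xs ys (g x) | ∑∑-++ xs ys g =
  rearrange (∑ xs (g x)) (∑ ys (g x)) (∑∑ xs g) (∑ xs (λ x → ∑ ys (g x))) (∑∑ ys g)
  where
  rearrange : ∀ a b c d e → a + b + (c + d + e) ≡ a + c + (b + d) + e
  rearrange = solve-∀

-- `∑∑` takes each pair of positions once, so a binomial coefficient appears; doubling avoids
-- halving in ℕ. Singletons are split off so that both truncated subtractions compute in the last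
-- case.
∑∑-const : ∀ {xs : List A} {g k} → AllPairs (λ x y → g x y ≡ k) xs →
  2 * ∑∑ xs g ≡ length xs * (length xs ∸ 1) * k
∑∑-const [] = refl
∑∑-const {xs = x ∷ []} (_ ∷ _) = refl
∑∑-const {xs = x ∷ xs@(_ ∷ ys)} {g} {k} (e ∷ es) = begin
  2 * (∑ xs (g x) + ∑∑ xs g)                         ≡⟨ ℕ.*-distribˡ-+ 2 (∑ xs (g x)) _ ⟩
  2 * ∑ xs (g x) + 2 * ∑∑ xs g                       ≡⟨ cong₂ (λ m n → 2 * m + n) (∑-All-const e) (∑∑-const es) ⟩
  2 * (suc l * k) + suc l * l * k                    ≡⟨ rearrange l k ⟩
  suc (suc l) * suc l * k                            ∎
  where
  open ≡-Reasoning
  l = length ys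
  rearrange : ∀ l k → 2 * (suc l * k) + suc l * l * k ≡ suc (suc l) * suc l * k
  rearrange = solve-∀

∑-∑∑-comm : ∀ (fs : List B) (xs : List A) (g : B → A → A → ℕ) →
  ∑ fs (λ f → ∑∑ xs (g f)) ≡ ∑∑ xs (λ x y → ∑ fs (λ f → g f x y))
∑-∑∑-comm fs []       g = trans (∑-const fs 0) (ℕ.*-zeroʳ (length fs))
∑-∑∑-comm fs (x ∷ xs) g = trans (∑-distrib-+ fs _ _)
  (cong₂ _+_ (∑-comm fs xs (λ f → g f x)) (∑-∑∑-comm fs xs g))

∑∑-distribˡ-* : ∀ (xs : List A) k g → ∑∑ xs (λ x y → k * g x y) ≡ k * ∑∑ xs g
∑∑-distribˡ-* []       k g = sym (ℕ.*-zeroʳ k)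
∑∑-distribˡ-* (x ∷ xs) k g =
  trans (cong₂ _+_ (∑-distribˡ-* xs k (g x)) (∑∑-distribˡ-* xs k g)) (sym (ℕ.*-distribˡ-+ k _ _))

-- If the head satisfies `P`, its own pairs already count every later entry satisfying `P`, so the
-- estimate closes without induction. If not, the bound for the tail suffices, since the extra pairs
-- add a nonnegative amount.
bonferroni : ∀ {P : A → Set ℓ₄} (P? : ∀ x → Dec (P x)) xs →
  ∑ xs (λ x → ⟦ P? x ⟧) ≤ 1 + ∑∑ xs (λ x y → ⟦ P? x ⟧ * ⟦ P? y ⟧)
bonferroni P? [] = z≤n
bonferroni P? (x ∷ xs) with P? x
... | no _  = ℕ.≤-trans (bonferroni P? xs) (s≤s (ℕ.m≤n+m _ _))
... | yes _ = s≤s (ℕ.≤-trans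
  (ℕ.≤-reflexive (∑-cong xs λ y → sym (ℕ.*-identityˡ ⟦ P? y ⟧)))
  (ℕ.m≤m+n _ _))

pairwise : ∀ {P : A → Set ℓ₄} {R : A → A → Set ℓ₅} →
  (∀ {x y} → P x → P y → x ≢ y → R x y) → ∀ {xs} → All P xs → Unique xs → AllPairs R xs
pairwise f []         []           = []
pairwise f (px ∷ pxs) (x∉xs ∷ xs!) =
  All.zipWith (λ { (py , x≢y) → f px py x≢y }) (pxs , x∉xs) ∷ pairwise f pxs xs!

-- The cutoff `μ`.

μ≤ : ∀ q t d m → μ q t d m ≤ m
μ≤ q t d zero = z≤n
μ≤ q t d (suc m) with (suc m * (q ^ (t ∸ d) ∸ 1)) <? (q ^ t ∸ 1)
... | yes _ = ℕ.≤-refl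
... | no _  = ℕ.m≤n⇒m≤1+n (μ≤ q t d m)

-- The search behind `μ` descends from m to the first value passing the test, and smaller x pass by
-- monotonicity. `1 ≤ x` rules out the end of the search, where 0 is returned untested.
≤μ⇒< : ∀ q t d m {x} → 1 ≤ x → x ≤ μ q t d m → x * (q ^ (t ∸ d) ∸ 1) < q ^ t ∸ 1
≤μ⇒< q t d zero    (s≤s _) ()
≤μ⇒< q t d (suc m) 1≤x x≤μ with (suc m * (q ^ (t ∸ d) ∸ 1)) <? (q ^ t ∸ 1)
... | yes m<  = ℕ.≤-<-trans (ℕ.*-monoˡ-≤ (q ^ (t ∸ d) ∸ 1) x≤μ) m<
... | no  _   = ≤μ⇒< q t d m 1≤x x≤μ

-- Embedding integers and naturals in ℚ.

toℚᵘ-/1 : ∀ i → toℚᵘ (i / 1) ℚᵘ.≃ ℚᵘ.mkℚᵘ i 0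
toℚᵘ-/1 i = ℚ.toℚᵘ-fromℚᵘ (ℚᵘ.mkℚᵘ i 0)

-- `_/_` on ℚ normalises by a gcd, so the identity is checked in ℚᵘ, where `i / 1` becomes an
-- unreduced fraction and the operations compute.
/1-homo-+ : ∀ i j → (i ℤ.+ j) / 1 ≡ i / 1 ℚ.+ j / 1
/1-homo-+ i j = ℚ.toℚᵘ-injective (begin-equality
  toℚᵘ ((i ℤ.+ j) / 1)                    ≃⟨ toℚᵘ-/1 (i ℤ.+ j) ⟩
  ℚᵘ.mkℚᵘ (i ℤ.+ j) 0                     ≡⟨ cong₂ (λ x y → ℚᵘ.mkℚᵘ (x ℤ.+ y) 0) (ℤ.*-identityʳ i) (ℤ.*-identityʳ j) ⟨
  ℚᵘ.mkℚᵘ i 0 ℚᵘ.+ ℚᵘ.mkℚᵘ j 0            ≃⟨ ℚᵘ.+-cong (toℚᵘ-/1 i) (toℚᵘ-/1 j) ⟨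
  toℚᵘ (i / 1) ℚᵘ.+ toℚᵘ (j / 1)          ≃⟨ ℚ.toℚᵘ-homo-+ (i / 1) (j / 1) ⟨
  toℚᵘ (i / 1 ℚ.+ j / 1)                  ∎)
  where open ℚᵘ.≤-Reasoning

/1-homo-* : ∀ i j → (i ℤ.* j) / 1 ≡ i / 1 ℚ.* (j / 1)
/1-homo-* i j = ℚ.toℚᵘ-injective (begin-equality
  toℚᵘ ((i ℤ.* j) / 1)                    ≃⟨ toℚᵘ-/1 (i ℤ.* j) ⟩
  ℚᵘ.mkℚᵘ i 0 ℚᵘ.* ℚᵘ.mkℚᵘ j 0            ≃⟨ ℚᵘ.*-cong (toℚᵘ-/1 i) (toℚᵘ-/1 j) ⟨
  toℚᵘ (i / 1) ℚᵘ.* toℚᵘ (j / 1)          ≃⟨ ℚ.toℚᵘ-homo-* (i / 1) (j / 1) ⟨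
  toℚᵘ (i / 1 ℚ.* (j / 1))                ∎)
  where open ℚᵘ.≤-Reasoning

ℕ→ℚ-homo-+ : ∀ m n → ℕ→ℚ (m + n) ≡ ℕ→ℚ m ℚ.+ ℕ→ℚ n
ℕ→ℚ-homo-+ m n = /1-homo-+ (+ m) (+ n)

ℕ→ℚ-homo-* : ∀ m n → ℕ→ℚ (m * n) ≡ ℕ→ℚ m ℚ.* ℕ→ℚ n
ℕ→ℚ-homo-* m n = trans (cong (_/ 1) (ℤ.pos-* m n)) (/1-homo-* (+ m) (+ n))

ℕ→ℚ-mono-≤ : ∀ {m n} → m ≤ n → ℕ→ℚ m ℚ.≤ ℕ→ℚ n
ℕ→ℚ-mono-≤ {m} {n} m≤n = ℚ.toℚᵘ-cancel-≤ (begin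
  toℚᵘ (ℕ→ℚ m)        ≃⟨ toℚᵘ-/1 (+ m) ⟩
  ℚᵘ.mkℚᵘ (+ m) 0     ≤⟨ ℚᵘ.*≤* (ℤ.*-monoʳ-≤-nonNeg (+ 1) (ℤ.+≤+ m≤n)) ⟩
  ℚᵘ.mkℚᵘ (+ n) 0     ≃⟨ toℚᵘ-/1 (+ n) ⟨
  toℚᵘ (ℕ→ℚ n)        ∎)
  where open ℚᵘ.≤-Reasoning

ℕ→ℚ-*-inverse : ∀ k → ℕ→ℚ (suc k) ℚ.* (+ 1 / suc k) ≡ 1ℚ
ℕ→ℚ-*-inverse k = ℚ.toℚᵘ-injective (begin-equality
  toℚᵘ (ℕ→ℚ (suc k) ℚ.* (+ 1 / suc k))
    ≃⟨ ℚ.toℚᵘ-homo-* (ℕ→ℚ (suc k)) (+ 1 / suc k) ⟩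
  toℚᵘ (ℕ→ℚ (suc k)) ℚᵘ.* toℚᵘ (+ 1 / suc k)
    ≃⟨ ℚᵘ.*-cong (toℚᵘ-/1 (+ suc k)) (ℚ.toℚᵘ-fromℚᵘ (ℚᵘ.mkℚᵘ (+ 1) k)) ⟩
  ℚᵘ.mkℚᵘ (+ suc k) 0 ℚᵘ.* ℚᵘ.mkℚᵘ (+ 1) k
    ≃⟨ ℚᵘ.*≡* (cong +_ (identity k)) ⟩
  ℚᵘ.1ℚᵘ ∎)
  where
  open ℚᵘ.≤-Reasoning
  identity : ∀ k → suc k * 1 * 1 ≡ 1 * (1 * suc k)
  identity = solve-∀

-- Solving the counting inequality for a.

-divℕ-≤ : ∀ x p a {D} → 0 < D →
  x ℚ.* ℕ→ℚ D ℚ.- p ℚ.≤ a ℚ.* ℕ→ℚ D → x ℚ.- divℕ p D ℚ.≤ a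
-- Matching on `0 < D` selects the branch where `divℕ` is true division rather than its default 0.
-divℕ-≤ x p a {suc k} (s≤s _) h = begin
  x ℚ.- p ℚ.* r              ≡⟨ cong (ℚ._- p ℚ.* r) (x≡xDr x) ⟩
  x ℚ.* D ℚ.* r ℚ.- p ℚ.* r  ≡⟨ solve 3 (λ y p r → y :* r :- p :* r := (y :- p) :* r) refl (x ℚ.* D) p r ⟩
  (x ℚ.* D ℚ.- p) ℚ.* r      ≤⟨ ℚ.*-monoʳ-≤-nonNeg r {{ℚ.normalize-nonNeg 1 (suc k)}} h ⟩
  a ℚ.* D ℚ.* r              ≡⟨ x≡xDr a ⟨
  a                          ∎
  where
  open ℚ.≤-Reasoning
  open +-*-Solver
  D = ℕ→ℚ (suc k)
  r = + 1 / suc k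
  x≡xDr : ∀ x → x ≡ x ℚ.* D ℚ.* r
  x≡xDr x = sym (trans (ℚ.*-assoc x D r) (trans (cong (x ℚ.*_) (ℕ→ℚ-*-inverse k)) (ℚ.*-identityʳ x)))

-- Here Q = D + x * v + 1 and u = 1 + v stand for qᵗ and qᵗ⁻ᵈ, and c for the number
-- of members of dimension t.
clear-denominator : ∀ y c D v → let x = suc y ; w = D + x * v ; Q = suc w ; u = suc v in
  2 * (x * (Q * u ∸ 1) + c * (Q ∸ 1))
    ≤ 2 * (Q * Q ∸ 1) + (x * y * (u * u ∸ 1) + 2 * (x * (c * (u ∸ 1)))) →
  2 * (x * D) + 2 * (c * D) ≤ 2 * ((w + 2) * D) + x * y * (v * v)
clear-denominator y c D v h =
  -- The summand cancelled is the left side of `h` with its truncated subtractions evaluated; the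
  -- rest is a polynomial identity without subtraction.
  ℕ.+-cancelˡ-≤ (2 * (suc y * (v + (D + suc y * v) * suc v) + c * (D + suc y * v))) _ _
    (ℕ.≤-trans (ℕ.+-monoˡ-≤ (2 * (suc y * D) + 2 * (c * D)) h)
      (ℕ.≤-reflexive (sym (balance y c D v))))
  where
  balance : ∀ y c D v →
    2 * (suc y * (v + (D + suc y * v) * suc v) + c * (D + suc y * v))
      + (2 * ((D + suc y * v + 2) * D) + suc y * y * (v * v))
    ≡ 2 * (D + suc y * v + (D + suc y * v) * suc (D + suc y * v))
      + (suc y * y * (v + v * suc v) + 2 * (suc y * (c * v)))
      + (2 * (suc y * D) + 2 * (c * D))
  balance = solve-∀

-- Since D + xv + 2 plays the role of Q + 1, the equation for c says c + a = Q + 1. The bracket from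
-- `R` at u = 1 + v is v²/2, so halving the inequality and subtracting cD leaves exactly the claim.
rational-bound : ∀ {x z c D v} (a : ℤ) →
  (+ c) ≡ + (D + x * v + 2) ℤ.- a →
  2 * (x * D) + 2 * (c * D) ≤ 2 * ((D + x * v + 2) * D) + z * (v * v) →
  ℕ→ℚ x ℚ.* ℕ→ℚ D
    ℚ.- ℕ→ℚ z ℚ.* (½ ℚ.* (ℕ→ℚ (suc v * suc v) ℚ.- 1ℚ) ℚ.+ 1ℚ ℚ.- ℕ→ℚ (suc v))
    ℚ.≤ a / 1 ℚ.* ℕ→ℚ D
rational-bound {x} {z} {c} {D} {v} a c≡ h = begin
  X ℚ.* D′ ℚ.- p (ℕ→ℚ (suc v * suc v)) (ℕ→ℚ (suc v))
    ≡⟨ cong₂ (λ s t → X ℚ.* D′ ℚ.- p s t) (trans (ℕ→ℚ-homo-* (suc v) (suc v)) (cong₂ ℚ._*_ U≡ U≡)) U≡ ⟩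
  X ℚ.* D′ ℚ.- p (U ℚ.* U) U
    -- Adding and subtracting `c′ ℚ.* D′` exposes half the left side of `h′`.
    ≡⟨ solve 5 (λ X D c′ Z V →
         X :* D :- pₛ Z V
           := con ½ :* (two :* (X :* D) :+ two :* (c′ :* D)) :- c′ :* D :- pₛ Z V)
         refl X D′ c′ Z V ⟩
  ½ ℚ.* (2ℚ ℚ.* (X ℚ.* D′) ℚ.+ 2ℚ ℚ.* (c′ ℚ.* D′)) ℚ.- c′ ℚ.* D′ ℚ.- p (U ℚ.* U) U
    ≤⟨ ℚ.+-monoˡ-≤ _ (ℚ.+-monoˡ-≤ _ (ℚ.*-monoˡ-≤-nonNeg ½ h′)) ⟩
  ½ ℚ.* (2ℚ ℚ.* ((c′ ℚ.+ a′) ℚ.* D′) ℚ.+ Z ℚ.* (V ℚ.* V)) ℚ.- c′ ℚ.* D′ ℚ.- p (U ℚ.* U) U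
    -- `pₛ Z V` equals half of Z V², so it cancels the quadratic term.
    ≡⟨ solve 5 (λ a′ D c′ Z V →
         con ½ :* (two :* ((c′ :+ a′) :* D) :+ Z :* (V :* V)) :- c′ :* D :- pₛ Z V
           := a′ :* D)
         refl a′ D′ c′ Z V ⟩
  a′ ℚ.* D′ ∎
  where
  open ℚ.≤-Reasoning
  open +-*-Solver
  2ℚ = 1ℚ ℚ.+ 1ℚ
  X = ℕ→ℚ x
  D′ = ℕ→ℚ D
  c′ = ℕ→ℚ c
  V = ℕ→ℚ v
  U = 1ℚ ℚ.+ V
  Z = ℕ→ℚ z
  a′ = a / 1
  p : ℚ → ℚ → ℚ
  p UU U = Z ℚ.* (½ ℚ.* (UU ℚ.- 1ℚ) ℚ.+ 1ℚ ℚ.- U)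
  two = con 1ℚ :+ con 1ℚ
  pₛ = λ Z V → Z :* (con ½ :* ((con 1ℚ :+ V) :* (con 1ℚ :+ V) :- con 1ℚ) :+ con 1ℚ :- (con 1ℚ :+ V))
  U≡ : ℕ→ℚ (suc v) ≡ U
  U≡ = ℕ→ℚ-homo-+ 1 v
  2*≡ : ∀ m n → ℕ→ℚ (2 * (m * n)) ≡ 2ℚ ℚ.* (ℕ→ℚ m ℚ.* ℕ→ℚ n)
  2*≡ m n = trans (ℕ→ℚ-homo-* 2 (m * n)) (cong (ℕ→ℚ 2 ℚ.*_) (ℕ→ℚ-homo-* m n))
  c′+a′≡ : ℕ→ℚ (D + x * v + 2) ≡ c′ ℚ.+ a′
  c′+a′≡ = trans (cong (_/ 1) (sym c+a≡)) (/1-homo-+ (+ c) a)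
    where
    c+a≡ : + c ℤ.+ a ≡ + (D + x * v + 2)
    c+a≡ = trans (cong (ℤ._+ a) c≡)
      (trans (ℤ.+-assoc (+ (D + x * v + 2)) (ℤ.- a) a)
        (trans (cong (ℤ._+_ (+ (D + x * v + 2))) (ℤ.+-inverseˡ a)) (ℤ.+-identityʳ _)))
  h′ : 2ℚ ℚ.* (X ℚ.* D′) ℚ.+ 2ℚ ℚ.* (c′ ℚ.* D′) ℚ.≤ 2ℚ ℚ.* ((c′ ℚ.+ a′) ℚ.* D′) ℚ.+ Z ℚ.* (V ℚ.* V)
  h′ = begin
    2ℚ ℚ.* (X ℚ.* D′) ℚ.+ 2ℚ ℚ.* (c′ ℚ.* D′)
      ≡⟨ cong₂ ℚ._+_ (2*≡ x D) (2*≡ c D) ⟨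
    ℕ→ℚ (2 * (x * D)) ℚ.+ ℕ→ℚ (2 * (c * D))
      ≡⟨ ℕ→ℚ-homo-+ (2 * (x * D)) (2 * (c * D)) ⟨
    ℕ→ℚ (2 * (x * D) + 2 * (c * D))
      ≤⟨ ℕ→ℚ-mono-≤ h ⟩
    ℕ→ℚ (2 * ((D + x * v + 2) * D) + z * (v * v))
      ≡⟨ ℕ→ℚ-homo-+ (2 * ((D + x * v + 2) * D)) (z * (v * v)) ⟩
    ℕ→ℚ (2 * ((D + x * v + 2) * D)) ℚ.+ ℕ→ℚ (z * (v * v))
      ≡⟨ cong₂ ℚ._+_
           (trans (2*≡ (D + x * v + 2) D) (cong (λ e → 2ℚ ℚ.* (e ℚ.* D′)) c′+a′≡))
           (trans (ℕ→ℚ-homo-* z (v * v)) (cong (Z ℚ.*_) (ℕ→ℚ-homo-* v v))) ⟩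
    2ℚ ℚ.* ((c′ ℚ.+ a′) ℚ.* D′) ℚ.+ Z ℚ.* (V ℚ.* V) ∎

-- Vectors over a finite field and their enumeration.

module LinearAlgebra {c ℓ : Level} {q : ℕ} (𝔽 : FiniteField c ℓ q) where
  open FiniteField 𝔽
  open CommutativeRing ring hiding (ring; zero)
    renaming (_+_ to _⊕_; _*_ to _⊗_; -_ to ⊖_; refl to ≈-refl; sym to ≈-sym; trans to ≈-trans)
  open RingProperties (CommutativeRing.ring ring) using (-‿distribˡ-*; -1*x≈-x; +-inverseˡ-unique)
  open SemiringSum semiring
    using (sum; sum-cong-≋; sum-replicate-zero; *-distribˡ-sum)
    renaming (∑-comm to sum-comm)
  open module VS {n} = VectorSpace 𝔽 n

  abstract
    -- Equality is decided on indices under `enum`. Being abstract, the decisions stay folded inside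
    -- indicators.
    _≈?_ : ∀ x y → Dec (x ≈ y)
    x ≈? y with enum-surj x | enum-surj y
    ... | i , ei≈x | j , ej≈y =
      map′ (λ { refl → ≈-trans (≈-sym ei≈x) ej≈y })
           (λ x≈y → enum-inj i j (≈-trans ei≈x (≈-trans x≈y (≈-sym ej≈y))))
           (i Fin.≟ j)

    zero? : ∀ {n} (v : Vec {n}) → Dec (IsZero v)
    zero? v = Fin.all? (λ j → v j ≈? 0#)

  -- 0 and 1 differ, so their indices in `Fin q` differ.
  1<q : 1 ℕ.< q
  1<q = go (proj₁ (enum-surj 0#)) (proj₁ (enum-surj 1#)) λ i≡j →
    0≉1 (≈-trans (≈-sym (proj₂ (enum-surj 0#)))
          (≈-trans (reflexive (cong enum i≡j)) (proj₂ (enum-surj 1#))))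
    where
    go : ∀ {m} (i j : Fin m) → i ≢ j → 1 ℕ.< m
    go {suc zero}    zero zero i≢j = contradiction refl i≢j
    go {suc (suc m)} _    _    _   = ℕ.s≤s (ℕ.s≤s ℕ.z≤n)

  -- Vectors are functions, so the list is complete and repetition-free only up to `_≈_` in each
  -- coordinate. It is therefore used through sums rather than through membership.
  vectors : ∀ n → List (Vec {n})
  vectors zero    = (λ ()) ∷ []
  vectors (suc n) = cartesianProductWith (λ i v → enum i ◂ v) (allFin q) (vectors n)

  ∑-vectors-suc : ∀ n (g : Vec {suc n} → ℕ) →
    ∑ (vectors (suc n)) g ≡ ∑ (allFin q) λ i → ∑ (vectors n) λ v → g (enum i ◂ v)
  ∑-vectors-suc n g = ∑-cartesianProductWith _ (allFin q) (vectors n) g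

  ∑-scalars-const : ∀ k → ∑ (allFin q) (λ _ → k) ≡ q * k
  ∑-scalars-const k =
    trans (∑-const (allFin q) k) (cong (_* k) (length-tabulate (id {A = Fin q})))

  ∑-vectors-const : ∀ n k → ∑ (vectors n) (λ _ → k) ≡ q ^ n * k
  ∑-vectors-const zero    k = refl
  ∑-vectors-const (suc n) k = begin
    ∑ (vectors (suc n)) (λ _ → k)                ≡⟨ ∑-vectors-suc n _ ⟩
    ∑ (allFin q) (λ _ → ∑ (vectors n) λ _ → k)   ≡⟨ ∑-scalars-const _ ⟩
    q * ∑ (vectors n) (λ _ → k)                  ≡⟨ cong (q *_) (∑-vectors-const n k) ⟩
    q * (q ^ n * k)                              ≡⟨ ℕ.*-assoc q (q ^ n) k ⟨
    q ^ suc n * k                                ∎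
    where open ≡-Reasoning

  ∑-scalars-unique : ∀ {p} {P : Carrier → Set p} (P? : ∀ x → Dec (P x)) {x₀} →
    (∀ {x} → x ≈ x₀ → P x) → (∀ {x} → P x → x ≈ x₀) →
    ∑ (allFin q) (λ i → ⟦ P? (enum i) ⟧) ≡ 1
  ∑-scalars-unique P? {x₀} from to with enum-surj x₀
  ... | i₀ , e = ∑-⟦⟧-unique (P? ∘ enum) (from e)
    (λ i pi → enum-inj i i₀ (≈-trans (to pi) (≈-sym e))) (allFin⁺ q) (∈-allFin i₀)

  ⟦zero?⟧-∷ : ∀ {n} x (v : Vec {n}) → ⟦ zero? (x ◂ v) ⟧ ≡ ⟦ x ≈? 0# ⟧ * ⟦ zero? v ⟧
  ⟦zero?⟧-∷ x v = ⟦⟧-× (x ≈? 0#) (zero? v) (zero? (x ◂ v))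
    (λ z → z zero , λ j → z (suc j))
    (λ { z zs zero → z ; z zs (suc j) → zs j })

  -- The indicator of the zero vector factors over coordinates, and exactly one scalar in the
  -- enumeration is zero.
  ∑-⟦zero?⟧ : ∀ n → ∑ (vectors n) (λ v → ⟦ zero? v ⟧) ≡ 1
  ∑-⟦zero?⟧ zero    = cong (_+ 0) (⟦⟧-true (zero? (λ ())) λ ())
  ∑-⟦zero?⟧ (suc n) = begin
    ∑ (vectors (suc n)) (λ v → ⟦ zero? v ⟧)
      ≡⟨ ∑-vectors-suc n _ ⟩
    ∑ (allFin q) (λ i → ∑ (vectors n) λ v → ⟦ zero? (enum i ◂ v) ⟧)
      ≡⟨ ∑-cong (allFin q) (λ i → trans
           (∑-cong (vectors n) (λ v → ⟦zero?⟧-∷ (enum i) v))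
           (∑-distribˡ-* (vectors n) ⟦ enum i ≈? 0# ⟧ _)) ⟩
    ∑ (allFin q) (λ i → ⟦ enum i ≈? 0# ⟧ * ∑ (vectors n) λ v → ⟦ zero? v ⟧)
      ≡⟨ ∑-cong (allFin q) (λ i → trans (cong (⟦ enum i ≈? 0# ⟧ *_) (∑-⟦zero?⟧ n)) (ℕ.*-identityʳ _)) ⟩
    ∑ (allFin q) (λ i → ⟦ enum i ≈? 0# ⟧)
      ≡⟨ ∑-scalars-unique (_≈? 0#) id id ⟩
    1 ∎
    where open ≡-Reasoning

  -- Functionals and hyperplanes.

  dot : ∀ {n} → Vec {n} → Vec {n} → Carrier
  dot f w = sum (λ j → f j ⊗ w j)

  dot-zeroʳ : ∀ {n} (f w : Vec {n}) → IsZero w → dot f w ≈ 0#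
  dot-zeroʳ {n} f w z =
    ≈-trans (sum-cong-≋ (λ j → ≈-trans (*-congˡ (z j)) (zeroʳ (f j)))) (sum-replicate-zero n)

  dot-comm : ∀ {n} (f w : Vec {n}) → dot f w ≈ dot w f
  dot-comm f w = sum-cong-≋ (λ j → *-comm (f j) (w j))

  -- With the other coordinates of a functional fixed, this counts the choices for the coordinate
  -- paired with a nonzero entry.
  ∑-scalars-affine : ∀ {a} b → ¬ (a ≈ 0#) → ∑ (allFin q) (λ i → ⟦ (enum i ⊗ a ⊕ b) ≈? 0# ⟧) ≡ 1
  ∑-scalars-affine {a} b a≉0 with inverse a a≉0
  ... | a⁻¹ , aa⁻¹≈1 = ∑-scalars-unique (λ x → (x ⊗ a ⊕ b) ≈? 0#) {(⊖ b) ⊗ a⁻¹} from to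
    where
    open SetoidReasoning setoid
    from : ∀ {x} → x ≈ (⊖ b) ⊗ a⁻¹ → x ⊗ a ⊕ b ≈ 0#
    from {x} x≈ = begin
      x ⊗ a ⊕ b                  ≈⟨ +-congʳ (*-congʳ x≈) ⟩
      (⊖ b) ⊗ a⁻¹ ⊗ a ⊕ b        ≈⟨ +-congʳ (*-assoc _ _ _) ⟩
      (⊖ b) ⊗ (a⁻¹ ⊗ a) ⊕ b      ≈⟨ +-congʳ (*-congˡ (≈-trans (*-comm _ _) aa⁻¹≈1)) ⟩
      (⊖ b) ⊗ 1# ⊕ b             ≈⟨ +-congʳ (*-identityʳ _) ⟩
      (⊖ b) ⊕ b                  ≈⟨ -‿inverseˡ b ⟩
      0#                         ∎
    to : ∀ {x} → x ⊗ a ⊕ b ≈ 0# → x ≈ (⊖ b) ⊗ a⁻¹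
    to {x} e = begin
      x                ≈⟨ *-identityʳ x ⟨
      x ⊗ 1#           ≈⟨ *-congˡ aa⁻¹≈1 ⟨
      x ⊗ (a ⊗ a⁻¹)    ≈⟨ *-assoc _ _ _ ⟨
      x ⊗ a ⊗ a⁻¹      ≈⟨ *-congʳ (+-inverseˡ-unique _ _ e) ⟩
      (⊖ b) ⊗ a⁻¹      ∎

  -- The hyperplane orthogonal to w has qⁿ⁻¹ elements, or qⁿ if w = 0; both cases in one
  -- subtraction-free formula, multiplied by q.
  ∑-⟦dot≈0⟧ : ∀ n (w : Vec {n}) →
    q * ∑ (vectors n) (λ f → ⟦ dot f w ≈? 0# ⟧) ≡ q ^ n * (1 + ℕ.pred q * ⟦ zero? w ⟧)
  -- In dimension 0 the only vector is zero and the count is 1; the exceptional summand supplies the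
  -- missing q - 1.
  ∑-⟦dot≈0⟧ zero w
    rewrite ⟦⟧-true (zero? w) (λ ()) | ⟦⟧-true (0# ≈? 0#) ≈-refl = begin
      q * 1                      ≡⟨ ℕ.*-identityʳ q ⟩
      q                          ≡⟨ ℕ.suc-pred q {{ℕ.>-nonZero (ℕ.<⇒≤ 1<q)}} ⟨
      suc (ℕ.pred q)             ≡⟨ lemma (ℕ.pred q) ⟨
      1 * (1 + ℕ.pred q * 1)     ∎
    where
    open ≡-Reasoning
    lemma : ∀ p → 1 * (1 + p * 1) ≡ suc p
    lemma = solve-∀
  ∑-⟦dot≈0⟧ (suc n) w with w zero ≈? 0#
  -- The first coordinate of f is free and does not affect the product.
  ... | yes w₀≈0 = begin
    q * ∑ (vectors (suc n)) (λ f → ⟦ dot f w ≈? 0# ⟧)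
      ≡⟨ cong (q *_) (∑-vectors-suc n _) ⟩
    q * ∑ (allFin q) (λ i → ∑ (vectors n) λ f → ⟦ dot (enum i ◂ f) w ≈? 0# ⟧)
      ≡⟨ cong (q *_) (∑-cong (allFin q) λ i → ∑-cong (vectors n) λ f →
           ⟦⟧-cong (dot (enum i ◂ f) w ≈? 0#) (dot f w′ ≈? 0#)
             (≈-trans (≈-sym (drop i f))) (≈-trans (drop i f))) ⟩
    q * ∑ (allFin q) (λ i → ∑ (vectors n) λ f → ⟦ dot f w′ ≈? 0# ⟧)
      ≡⟨ cong (q *_) (∑-scalars-const _) ⟩
    q * (q * ∑ (vectors n) (λ f → ⟦ dot f w′ ≈? 0# ⟧))
      ≡⟨ cong (q *_) (∑-⟦dot≈0⟧ n w′) ⟩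
    q * (q ^ n * (1 + ℕ.pred q * ⟦ zero? w′ ⟧))
      ≡⟨ ℕ.*-assoc q (q ^ n) _ ⟨
    q ^ suc n * (1 + ℕ.pred q * ⟦ zero? w′ ⟧)
      ≡⟨ cong (λ k → q ^ suc n * (1 + ℕ.pred q * k))
           (⟦⟧-cong (zero? w′) (zero? w) (λ { z zero → w₀≈0 ; z (suc j) → z j }) (_∘ suc)) ⟩
    q ^ suc n * (1 + ℕ.pred q * ⟦ zero? w ⟧) ∎
    where
    open ≡-Reasoning
    w′ = w ∘ suc
    drop : ∀ i f → dot (enum i ◂ f) w ≈ dot f w′
    drop i f = ≈-trans (+-congʳ (≈-trans (*-congˡ w₀≈0) (zeroʳ _))) (+-identityˡ _)
  -- Each choice of the remaining coordinates of f determines the first one uniquely.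
  ... | no w₀≉0 = begin
    q * ∑ (vectors (suc n)) (λ f → ⟦ dot f w ≈? 0# ⟧)
      ≡⟨ cong (q *_) (∑-vectors-suc n _) ⟩
    q * ∑ (allFin q) (λ i → ∑ (vectors n) λ f → ⟦ dot (enum i ◂ f) w ≈? 0# ⟧)
      ≡⟨ cong (q *_) (∑-comm (allFin q) (vectors n) _) ⟩
    q * ∑ (vectors n) (λ f → ∑ (allFin q) λ i → ⟦ dot (enum i ◂ f) w ≈? 0# ⟧)
      ≡⟨ cong (q *_) (∑-cong (vectors n) λ f → ∑-scalars-affine (dot f (w ∘ suc)) w₀≉0) ⟩
    q * ∑ (vectors n) (λ f → 1)
      ≡⟨ cong (q *_) (∑-vectors-const n 1) ⟩
    q * (q ^ n * 1)
      ≡⟨ ℕ.*-assoc q (q ^ n) 1 ⟨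
    q ^ suc n * 1
      ≡⟨ cong (λ k → q ^ suc n * suc k) (ℕ.*-zeroʳ (ℕ.pred q)) ⟨
    q ^ suc n * (1 + ℕ.pred q * 0)
      ≡⟨ cong (λ k → q ^ suc n * (1 + ℕ.pred q * k)) (⟦⟧-false (zero? w) (λ z → w₀≉0 (z zero))) ⟨
    q ^ suc n * (1 + ℕ.pred q * ⟦ zero? w ⟧) ∎
    where open ≡-Reasoning

  -- Functionals annihilating a subspace.

  evaluate : ∀ {n d} → Vec {n} → (Fin d → Vec {n}) → Vec {d}
  evaluate f b i = dot f (b i)

  -- Exchanging the two sums shows that evaluation is the transpose of `lincomb`; the double count
  -- below rests on this symmetry between functionals and coefficients.
  dot-lincomb : ∀ {n d} (f : Vec {n}) (cs : Vec {d}) b →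
    dot f (lincomb cs b) ≈ dot cs (evaluate f b)
  dot-lincomb {n} {d} f cs b = begin
    sum {n} (λ j → f j ⊗ sum {d} (λ i → cs i ⊗ b i j))
      ≈⟨ sum-cong-≋ (λ j → *-distribˡ-sum (f j) (λ i → cs i ⊗ b i j)) ⟩
    sum {n} (λ j → sum {d} (λ i → f j ⊗ (cs i ⊗ b i j)))
      ≈⟨ sum-comm (λ j i → f j ⊗ (cs i ⊗ b i j)) ⟩
    sum {d} (λ i → sum {n} (λ j → f j ⊗ (cs i ⊗ b i j)))
      ≈⟨ sum-cong-≋ (λ i → sum-cong-≋ (λ j → swap (f j) (cs i) (b i j))) ⟩
    sum {d} (λ i → sum {n} (λ j → cs i ⊗ (f j ⊗ b i j)))
      ≈⟨ sum-cong-≋ (λ i → *-distribˡ-sum (cs i) (λ j → f j ⊗ b i j)) ⟨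
    sum {d} (λ i → cs i ⊗ sum {n} (λ j → f j ⊗ b i j)) ∎
    where
    open SetoidReasoning setoid
    swap : ∀ x y z → x ⊗ (y ⊗ z) ≈ y ⊗ (x ⊗ z)
    swap x y z = ≈-trans (≈-sym (*-assoc x y z)) (≈-trans (*-congʳ (*-comm x y)) (*-assoc y x z))

  lincomb-zero : ∀ {n d} (cs : Vec {d}) (b : Fin d → Vec {n}) → IsZero cs → IsZero (lincomb cs b)
  lincomb-zero cs b z j = ≈-trans (dot-comm cs _) (dot-zeroʳ _ cs z)

  evaluate-zero : ∀ {n d} (f : Vec {n}) (b : Fin d → Vec {n}) → IsZero f → IsZero (evaluate f b)
  evaluate-zero f b z i = ≈-trans (dot-comm f (b i)) (dot-zeroʳ (b i) f z)

  -- A vector f stands for the functional `dot f`. It vanishes on a span exactly when it vanishes on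
  -- the spanning family, so a finite test suffices.
  annihilates : ∀ {n d} → (Fin d → Vec {n}) → Vec {n} → ℕ
  annihilates b f = ⟦ zero? (evaluate f b) ⟧

  -- Count the pairs (f , cs) with f · lincomb cs b ≈ 0 in both orders, using ∑-⟦dot≈0⟧ twice.
  ∑-annihilates : ∀ {n d} (b : Fin d → Vec {n}) → LinearlyIndependent b →
    q ^ d * ∑ (vectors n) (annihilates b) ≡ q ^ n
  ∑-annihilates {n} {d} b indep =
    -- Both counts contain the term q^n q^d. Removing it leaves a common factor q - 1, nonzero by
    -- `1<q`.
    sym (ℕ.*-cancelˡ-≡ _ _ (ℕ.pred q) {{pq}} (ℕ.+-cancelˡ-≡ (q ^ n * q ^ d) _ _ (begin
      q ^ n * q ^ d + ℕ.pred q * q ^ n          ≡⟨ lem₁ (q ^ n) (q ^ d) (ℕ.pred q) ⟩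
      q ^ n * (q ^ d * 1 + ℕ.pred q * 1)        ≡⟨ byCoefficients ⟨
      q * ∑ (vectors d) (λ cs → ∑ (vectors n) λ f → ⟦ dot f (lincomb cs b) ≈? 0# ⟧)
        ≡⟨ cong (q *_) (∑-comm (vectors d) (vectors n) _) ⟩
      q * ∑ (vectors n) (λ f → ∑ (vectors d) λ cs → ⟦ dot f (lincomb cs b) ≈? 0# ⟧)
        ≡⟨ byFunctionals ⟩
      q ^ d * (q ^ n * 1 + ℕ.pred q * M)        ≡⟨ lem₂ (q ^ n) (q ^ d) (ℕ.pred q) M ⟩
      q ^ n * q ^ d + ℕ.pred q * (q ^ d * M)    ∎)))
    where
    open ≡-Reasoning
    M = ∑ (vectors n) (annihilates b)
    pq : NonZero (ℕ.pred q)
    pq = ℕ.>-nonZero (ℕ.pred-mono-≤ 1<q)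
    lem₁ : ∀ x y p → x * y + p * x ≡ x * (y * 1 + p * 1)
    lem₁ = solve-∀
    lem₂ : ∀ x y p a → y * (x * 1 + p * a) ≡ x * y + p * (y * a)
    lem₂ = solve-∀
    -- Sums the formula of `∑-⟦dot≈0⟧` over a list; h marks the exceptional entries, where the
    -- vector defining the hyperplane is zero.
    sum-weights : ∀ m k {e} {E : Set e} (xs : List E) (g h : E → ℕ) →
      (∀ x → q * g x ≡ q ^ m * (1 + k * h x)) →
      q * ∑ xs g ≡ q ^ m * (∑ xs (λ _ → 1) + k * ∑ xs h)
    sum-weights m k xs g h e = begin
      q * ∑ xs g                                     ≡⟨ ∑-distribˡ-* xs q g ⟨
      ∑ xs (λ x → q * g x)                           ≡⟨ ∑-cong xs e ⟩
      ∑ xs (λ x → q ^ m * (1 + k * h x))             ≡⟨ ∑-distribˡ-* xs (q ^ m) _ ⟩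
      q ^ m * ∑ xs (λ x → 1 + k * h x)               ≡⟨ cong (q ^ m *_) (∑-distrib-+ xs _ _) ⟩
      q ^ m * (∑ xs (λ _ → 1) + ∑ xs (λ x → k * h x))
        ≡⟨ cong (λ y → q ^ m * (∑ xs (λ _ → 1) + y)) (∑-distribˡ-* xs k h) ⟩
      q ^ m * (∑ xs (λ _ → 1) + k * ∑ xs h)          ∎
    byCoefficients :
      q * ∑ (vectors d) (λ cs → ∑ (vectors n) λ f → ⟦ dot f (lincomb cs b) ≈? 0# ⟧)
        ≡ q ^ n * (q ^ d * 1 + ℕ.pred q * 1)
    -- By independence, only zero coefficients give a zero combination, so there is a single
    -- exception.
    byCoefficients = trans
      (sum-weights n (ℕ.pred q) (vectors d) _ (λ cs → ⟦ zero? cs ⟧) λ cs →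
        trans (∑-⟦dot≈0⟧ n (lincomb cs b))
          (cong (λ k → q ^ n * (1 + ℕ.pred q * k))
            (⟦⟧-cong (zero? (lincomb cs b)) (zero? cs) (indep cs) (lincomb-zero cs b))))
      (cong₂ (λ x y → q ^ n * (x + ℕ.pred q * y)) (∑-vectors-const d 1) (∑-⟦zero?⟧ d))
    byFunctionals :
      q * ∑ (vectors n) (λ f → ∑ (vectors d) λ cs → ⟦ dot f (lincomb cs b) ≈? 0# ⟧)
        ≡ q ^ d * (q ^ n * 1 + ℕ.pred q * M)
    -- Here the exceptions are the functionals with zero evaluation vector, that is, the
    -- annihilators to be counted.
    byFunctionals = trans
      (sum-weights d (ℕ.pred q) (vectors n) _ (annihilates b) λ f →
        trans
          (cong (q *_) (∑-cong (vectors d) λ cs →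
            ⟦⟧-cong (dot f (lincomb cs b) ≈? 0#) (dot cs (evaluate f b) ≈? 0#)
              (≈-trans (≈-sym (dot-lincomb f cs b))) (≈-trans (dot-lincomb f cs b))))
          (∑-⟦dot≈0⟧ d (evaluate f b)))
      (cong (λ x → q ^ d * (x + ℕ.pred q * M)) (∑-vectors-const n 1))

  -- Concatenated bases.

  sum-++ : ∀ m {n} (g : Vec {m + n}) → sum g ≈ sum (g ∘ (_↑ˡ n)) ⊕ sum (g ∘ (m ↑ʳ_))
  sum-++ zero    g = ≈-sym (+-identityˡ _)
  sum-++ (suc m) g = ≈-trans (+-congˡ (sum-++ m (g ∘ suc))) (≈-sym (+-assoc _ _ _))

  ↑-elim : ∀ {m n p} (P : Fin (m + n) → Set p) →
    (∀ i → P (i ↑ˡ n)) → (∀ i → P (m ↑ʳ i)) → ∀ i → P i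
  ↑-elim {m} P l r i with splitAt m i in eq
  ... | inj₁ j = subst P (Fin.splitAt⁻¹-↑ˡ eq) (l j)
  ... | inj₂ j = subst P (Fin.splitAt⁻¹-↑ʳ eq) (r j)

  lincomb-++ : ∀ {n d e} (cs : Vec {d + e}) (b : Fin d → Vec {n}) (b′ : Fin e → Vec {n}) j →
    lincomb cs (b ⧺ b′) j ≈ lincomb (cs ∘ (_↑ˡ e)) b j ⊕ lincomb (cs ∘ (d ↑ʳ_)) b′ j
  lincomb-++ {d = d} {e} cs b b′ j = ≈-trans (sum-++ d _) (+-cong
    (sum-cong-≋ λ i → *-congˡ (reflexive (cong (λ v → v j) (lookup-++ˡ b b′ i))))
    (sum-cong-≋ λ i → *-congˡ (reflexive (cong (λ v → v j) (lookup-++ʳ b b′ i)))))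

  annihilates-++ : ∀ {n d e} (b : Fin d → Vec {n}) (b′ : Fin e → Vec {n}) f →
    annihilates (b ⧺ b′) f ≡ annihilates b f * annihilates b′ f
  annihilates-++ {d = d} b b′ f =
    ⟦⟧-× (zero? (evaluate f b)) (zero? (evaluate f b′)) (zero? (evaluate f (b ⧺ b′)))
      (λ z → (λ i → subst (λ v → dot f v ≈ 0#) (lookup-++ˡ b b′ i) (z _))
           , (λ i → subst (λ v → dot f v ≈ 0#) (lookup-++ʳ b b′ i) (z _)))
      (λ z z′ → ↑-elim {d} _
        (λ i → subst (λ v → dot f v ≈ 0#) (sym (lookup-++ˡ b b′ i)) (z i))
        (λ i → subst (λ v → dot f v ≈ 0#) (sym (lookup-++ʳ b b′ i)) (z′ i)))

  -- A vanishing combination splits as u + u′ = 0, so u = -u′ lies in both spans. Disjointness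
  -- forces u = 0, hence u′ = 0, and each half is settled by its own independence.
  independent-++ : ∀ {n d e} (b : Fin d → Vec {n}) (b′ : Fin e → Vec {n}) →
    LinearlyIndependent b → LinearlyIndependent b′ →
    (∀ v → NonZeroVec v → InSpan v b → ¬ InSpan v b′) → LinearlyIndependent (b ⧺ b′)
  independent-++ {n} {d} {e} b b′ indep indep′ disjoint cs z = ↑-elim {d} _ left right
    where
    csˡ = cs ∘ (_↑ˡ e)
    csʳ = cs ∘ (d ↑ʳ_)
    u⊕u′≈0 : ∀ j → lincomb csˡ b j ⊕ lincomb csʳ b′ j ≈ 0#
    u⊕u′≈0 j = ≈-trans (≈-sym (lincomb-++ cs b b′ j)) (z j)
    u≈-u′ : ∀ j → lincomb csˡ b j ≈ lincomb (λ i → ⊖ csʳ i) b′ j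
    u≈-u′ j = begin
      lincomb csˡ b j                       ≈⟨ +-inverseˡ-unique _ _ (u⊕u′≈0 j) ⟩
      ⊖ lincomb csʳ b′ j                    ≈⟨ -1*x≈-x _ ⟨
      (⊖ 1#) ⊗ lincomb csʳ b′ j             ≈⟨ *-distribˡ-sum {e} (⊖ 1#) _ ⟩
      sum {e} (λ i → (⊖ 1#) ⊗ (csʳ i ⊗ b′ i j))
        ≈⟨ sum-cong-≋ {e} (λ i → ≈-trans (-1*x≈-x _) (-‿distribˡ-* (csʳ i) (b′ i j))) ⟩
      lincomb (λ i → ⊖ csʳ i) b′ j          ∎
      where open SetoidReasoning setoid
    left : IsZero csˡ
    left with zero? (lincomb csˡ b)
    ... | yes u≈0 = indep csˡ u≈0
    ... | no  u≉0 = contradiction ((λ i → ⊖ csʳ i) , u≈-u′)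
                      (disjoint _ u≉0 (csˡ , λ _ → ≈-refl))
    right : IsZero csʳ
    right = indep′ csʳ λ j → begin
      lincomb csʳ b′ j                     ≈⟨ +-identityˡ _ ⟨
      0# ⊕ lincomb csʳ b′ j                ≈⟨ +-congʳ (lincomb-zero csˡ b left j) ⟨
      lincomb csˡ b j ⊕ lincomb csʳ b′ j   ≈⟨ u⊕u′≈0 j ⟩
      0#                                   ∎
      where open SetoidReasoning setoid

  -- Nonzero annihilators.

  q^n≢0 : ∀ n → NonZero (q ^ n)
  q^n≢0 n = ℕ.m^n≢0 q n {{ℕ.>-nonZero (ℕ.<⇒≤ 1<q)}}

  nonzero : ∀ {n} → Vec {n} → ℕ
  nonzero f = ⟦ ¬? (zero? f) ⟧

  nonzeroAnnihilators : ∀ {n d} → (Fin d → Vec {n}) → ℕ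
  nonzeroAnnihilators {n} b = ∑ (vectors n) λ f → nonzero f * annihilates b f

  annihilates-split : ∀ {n d} (b : Fin d → Vec {n}) f →
    annihilates b f ≡ ⟦ zero? f ⟧ + nonzero f * annihilates b f
  annihilates-split b f with zero? f
  ... | yes z = ⟦⟧-true (zero? (evaluate f b)) λ i → evaluate-zero f b z i
  ... | no _  = sym (ℕ.*-identityˡ _)

  -- k is the number of all annihilators, from which the zero functional is removed. Fixing it by
  -- `q ^ d * k ≡ q ^ n` avoids truncated subtraction in the exponent and admits products such as
  -- `Q * u`.
  nonzeroAnnihilators≡ : ∀ {n d k} (b : Fin d → Vec {n}) → LinearlyIndependent b →
    q ^ d * k ≡ q ^ n → nonzeroAnnihilators b ≡ k ∸ 1
  nonzeroAnnihilators≡ {n} {d} {k} b indep e = cong (_∸ 1) (begin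
    1 + nonzeroAnnihilators b
      ≡⟨ cong (_+ nonzeroAnnihilators b) (∑-⟦zero?⟧ n) ⟨
    ∑ (vectors n) (λ f → ⟦ zero? f ⟧) + nonzeroAnnihilators b
      ≡⟨ ∑-distrib-+ (vectors n) _ _ ⟨
    ∑ (vectors n) (λ f → ⟦ zero? f ⟧ + nonzero f * annihilates b f)
      ≡⟨ ∑-cong (vectors n) (annihilates-split b) ⟨
    ∑ (vectors n) (annihilates b)
      ≡⟨ ℕ.*-cancelˡ-≡ _ k (q ^ d) {{q^n≢0 d}} (trans (∑-annihilates b indep) (sym e)) ⟩
    k ∎)
    where open ≡-Reasoning

  ∑-nonzero : ∀ n → ∑ (vectors n) nonzero ≡ q ^ n ∸ 1
  ∑-nonzero n = cong (_∸ 1) (begin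
    1 + ∑ (vectors n) nonzero
      ≡⟨ cong (_+ ∑ (vectors n) nonzero) (∑-⟦zero?⟧ n) ⟨
    ∑ (vectors n) (λ f → ⟦ zero? f ⟧) + ∑ (vectors n) nonzero
      ≡⟨ ∑-distrib-+ (vectors n) _ _ ⟨
    ∑ (vectors n) (λ f → ⟦ zero? f ⟧ + nonzero f)
      ≡⟨ ∑-cong (vectors n) one ⟩
    ∑ (vectors n) (λ f → 1)
      ≡⟨ ∑-vectors-const n 1 ⟩
    q ^ n * 1
      ≡⟨ ℕ.*-identityʳ (q ^ n) ⟩
    q ^ n ∎)
    where
    open ≡-Reasoning
    one : ∀ f → ⟦ zero? f ⟧ + nonzero f ≡ 1
    one f with zero? f
    ... | yes _ = refl
    ... | no _  = refl

  -- The Bonferroni inequality for members of a partition.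

  module _ {n} (P : Partition {n}) where
    open Partition P

    annihilatorsOf : Fin N → ℕ
    annihilatorsOf i = nonzeroAnnihilators (basis i)

    commonAnnihilators : Fin N → Fin N → ℕ
    commonAnnihilators i j = nonzeroAnnihilators (basis i ⧺ basis j)

    -- Apply `bonferroni` to each nonzero functional and exchange sums. A product of two
    -- annihilation indicators is the indicator for the concatenated bases, which gives the pair
    -- terms.
    bonferroni-annihilators : ∀ L →
      ∑ L annihilatorsOf ≤ q ^ n ∸ 1 + ∑∑ L commonAnnihilators
    bonferroni-annihilators L = begin
      ∑ L annihilatorsOf
        ≡⟨ ∑-comm L (vectors n) _ ⟩
      ∑ (vectors n) (λ f → ∑ L λ i → nonzero f * K f i)
        ≡⟨ ∑-cong (vectors n) (λ f → ∑-distribˡ-* L (nonzero f) (K f)) ⟩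
      ∑ (vectors n) (λ f → nonzero f * ∑ L (K f))
        ≤⟨ ∑-mono (vectors n) (λ f → ℕ.*-monoʳ-≤ (nonzero f)
             (bonferroni (λ i → zero? (evaluate f (basis i))) L)) ⟩
      ∑ (vectors n) (λ f → nonzero f * (1 + ∑∑ L λ i j → K f i * K f j))
        ≡⟨ ∑-cong (vectors n) (λ f → begin-equality
             nonzero f * (1 + ∑∑ L λ i j → K f i * K f j)
               ≡⟨ ℕ.*-suc (nonzero f) _ ⟩
             nonzero f + nonzero f * ∑∑ L (λ i j → K f i * K f j)
               ≡⟨ cong (_+_ (nonzero f)) (∑∑-distribˡ-* L (nonzero f) _) ⟨
             nonzero f + ∑∑ L (λ i j → nonzero f * (K f i * K f j)) ∎) ⟩
      ∑ (vectors n) (λ f → nonzero f + ∑∑ L λ i j → nonzero f * (K f i * K f j))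
        ≡⟨ ∑-distrib-+ (vectors n) _ _ ⟩
      ∑ (vectors n) nonzero + ∑ (vectors n) (λ f → ∑∑ L λ i j → nonzero f * (K f i * K f j))
        ≡⟨ cong₂ _+_ (∑-nonzero n) (∑-∑∑-comm (vectors n) L _) ⟩
      q ^ n ∸ 1 + ∑∑ L (λ i j → ∑ (vectors n) λ f → nonzero f * (K f i * K f j))
        ≡⟨ cong (_+_ (q ^ n ∸ 1)) (∑∑-cong L λ i j → ∑-cong (vectors n) λ f →
             cong (nonzero f *_) (annihilates-++ (basis i) (basis j) f)) ⟨
      q ^ n ∸ 1 + ∑∑ L commonAnnihilators ∎
      where
      open ℕ.≤-Reasoning
      K : Vec → Fin N → ℕ
      K f i = annihilates (basis i) f

    -- By `unique`, distinct members share no nonzero vector, so their joined bases are independent.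
    commonAnnihilators≡ : ∀ {k} i j → i ≢ j → q ^ (dim i + dim j) * k ≡ q ^ n →
      commonAnnihilators i j ≡ k ∸ 1
    commonAnnihilators≡ i j i≢j = nonzeroAnnihilators≡ (basis i ⧺ basis j)
      (independent-++ (basis i) (basis j) (indep i) (indep j)
        λ v v≉0 v∈i v∈j → i≢j (unique v v≉0 i j v∈i v∈j))

  -- Annihilator counts for dimensions d and t.

  module _ {t d : ℕ} (P : Partition {2 * t}) (d<t : d < t) where
    open Partition P
    private
      Q = q ^ t
      u = q ^ (t ∸ d)

      q^d*u≡Q : q ^ d * u ≡ Q
      q^d*u≡Q = trans (sym (ℕ.^-distribˡ-+-* q d (t ∸ d)))
        (cong (q ^_) (ℕ.m+[n∸m]≡n (ℕ.<⇒≤ d<t)))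

      q^2t≡Q*Q : q ^ (2 * t) ≡ Q * Q
      q^2t≡Q*Q = trans (cong (λ s → q ^ (t + s)) (ℕ.+-identityʳ t)) (ℕ.^-distribˡ-+-* q t t)

    -- The codimension is 2t - d = t + (t - d), whence the factor `Q * u`.
    annihilatorsOf-d : ∀ {i} → dim i ≡ d → annihilatorsOf P i ≡ Q * u ∸ 1
    annihilatorsOf-d {i} i∈ = nonzeroAnnihilators≡ (basis i) (indep i) (begin
      q ^ dim i * (Q * u)  ≡⟨ cong (λ e → q ^ e * (Q * u)) i∈ ⟩
      q ^ d * (Q * u)      ≡⟨ swap (q ^ d) Q u ⟩
      Q * (q ^ d * u)      ≡⟨ cong (Q *_) q^d*u≡Q ⟩
      Q * Q                ≡⟨ q^2t≡Q*Q ⟨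
      q ^ (2 * t)          ∎)
      where
      open ≡-Reasoning
      swap : ∀ a b c → a * (b * c) ≡ b * (a * c)
      swap = solve-∀

    annihilatorsOf-t : ∀ {i} → dim i ≡ t → annihilatorsOf P i ≡ Q ∸ 1
    annihilatorsOf-t {i} i∈ = nonzeroAnnihilators≡ (basis i) (indep i)
      (trans (cong (λ e → q ^ e * Q) i∈) (sym q^2t≡Q*Q))

    commonAnnihilators-dd : ∀ {i j} → dim i ≡ d → dim j ≡ d → i ≢ j →
      commonAnnihilators P i j ≡ u * u ∸ 1
    commonAnnihilators-dd {i} {j} i∈ j∈ i≢j = commonAnnihilators≡ P i j i≢j (begin
      q ^ (dim i + dim j) * (u * u)  ≡⟨ cong₂ (λ a b → q ^ (a + b) * (u * u)) i∈ j∈ ⟩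
      q ^ (d + d) * (u * u)          ≡⟨ cong (_* (u * u)) (ℕ.^-distribˡ-+-* q d d) ⟩
      q ^ d * q ^ d * (u * u)        ≡⟨ interchange (q ^ d) u ⟩
      q ^ d * u * (q ^ d * u)        ≡⟨ cong₂ _*_ q^d*u≡Q q^d*u≡Q ⟩
      Q * Q                          ≡⟨ q^2t≡Q*Q ⟨
      q ^ (2 * t)                    ∎)
      where
      open ≡-Reasoning
      interchange : ∀ a b → a * a * (b * b) ≡ a * b * (a * b)
      interchange = solve-∀

    -- The two members are distinct because d < t, and their sum has codimension t - d.
    commonAnnihilators-dt : ∀ {i j} → dim i ≡ d → dim j ≡ t → commonAnnihilators P i j ≡ u ∸ 1
    commonAnnihilators-dt {i} {j} i∈ j∈ = commonAnnihilators≡ P i j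
      (λ i≡j → ℕ.<⇒≢ d<t (trans (sym i∈) (trans (cong dim i≡j) j∈)))
      (begin
      q ^ (dim i + dim j) * u  ≡⟨ cong₂ (λ a b → q ^ (a + b) * u) i∈ j∈ ⟩
      q ^ (d + t) * u          ≡⟨ cong (_* u) (ℕ.^-distribˡ-+-* q d t) ⟩
      q ^ d * Q * u            ≡⟨ swap (q ^ d) Q u ⟩
      q ^ d * u * Q            ≡⟨ cong (_* Q) q^d*u≡Q ⟩
      Q * Q                    ≡⟨ q^2t≡Q*Q ⟨
      q ^ (2 * t)              ∎)
      where
      open ≡-Reasoning
      swap : ∀ a b c → a * b * c ≡ a * c * b
      swap = solve-∀

    -- Two such members span the whole space, so only the zero functional kills both.
    commonAnnihilators-tt : ∀ {i j} → dim i ≡ t → dim j ≡ t → i ≢ j → commonAnnihilators P i j ≡ 0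
    commonAnnihilators-tt {i} {j} i∈ j∈ i≢j = commonAnnihilators≡ P i j i≢j (begin
      q ^ (dim i + dim j) * 1  ≡⟨ ℕ.*-identityʳ _ ⟩
      q ^ (dim i + dim j)      ≡⟨ cong₂ (λ a b → q ^ (a + b)) i∈ j∈ ⟩
      q ^ (t + t)              ≡⟨ cong (λ s → q ^ (t + s)) (ℕ.+-identityʳ t) ⟨
      q ^ (2 * t)              ∎)
      where open ≡-Reasoning

    -- The Bonferroni bound for S and T together, doubled to keep x(x - 1)/2 integral.
    counting-inequality : ∀ {x} → x ≤ count d →
      2 * (x * (Q * u ∸ 1) + count t * (Q ∸ 1))
        ≤ 2 * (Q * Q ∸ 1) + (x * (x ∸ 1) * (u * u ∸ 1) + 2 * (x * (count t * (u ∸ 1))))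
    counting-inequality {x} x≤ = begin
      2 * (x * (Q * u ∸ 1) + count t * (Q ∸ 1))
        ≡⟨ cong (2 *_) singles ⟨
      2 * ∑ (S ++ T) (annihilatorsOf P)
        ≤⟨ ℕ.*-monoʳ-≤ 2 (bonferroni-annihilators P (S ++ T)) ⟩
      2 * (q ^ (2 * t) ∸ 1 + ∑∑ (S ++ T) g)
        ≡⟨ ℕ.*-distribˡ-+ 2 (q ^ (2 * t) ∸ 1) _ ⟩
      2 * (q ^ (2 * t) ∸ 1) + 2 * ∑∑ (S ++ T) g
        ≡⟨ cong₂ (λ a b → 2 * (a ∸ 1) + b) q^2t≡Q*Q pairs ⟩
      2 * (Q * Q ∸ 1) + (x * (x ∸ 1) * (u * u ∸ 1) + 2 * (x * (count t * (u ∸ 1)))) ∎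
      where
      open ℕ.≤-Reasoning
      g = commonAnnihilators P
      membersOfDim : ℕ → List (Fin N)
      membersOfDim e = filter (λ i → dim i ℕ.≟ e) (allFin N)
      -- Any x members of dimension d would serve; `x≤` ensures that the prefix has full length.
      S = take x (membersOfDim d)
      T = membersOfDim t
      S-dim : All (λ i → dim i ≡ d) S
      S-dim = All.take⁺ x (All.all-filter (λ i → dim i ℕ.≟ d) (allFin N))
      T-dim : All (λ i → dim i ≡ t) T
      T-dim = All.all-filter (λ i → dim i ℕ.≟ t) (allFin N)
      S! : Unique S
      S! = take⁺ x (filter⁺ (λ i → dim i ℕ.≟ d) (allFin⁺ N))
      T! : Unique T
      T! = filter⁺ (λ i → dim i ℕ.≟ t) (allFin⁺ N)
      |S|≡x : length S ≡ x
      |S|≡x = trans (length-take x (membersOfDim d)) (ℕ.m≤n⇒m⊓n≡m x≤)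
      singles : ∑ (S ++ T) (annihilatorsOf P) ≡ x * (Q * u ∸ 1) + count t * (Q ∸ 1)
      singles = trans (∑-++ S T _) (cong₂ _+_
        (trans (∑-All-const (All.map annihilatorsOf-d S-dim)) (cong (_* (Q * u ∸ 1)) |S|≡x))
        (∑-All-const (All.map annihilatorsOf-t T-dim)))
      pairs-SS : 2 * ∑∑ S g ≡ x * (x ∸ 1) * (u * u ∸ 1)
      pairs-SS = trans (∑∑-const (pairwise commonAnnihilators-dd S-dim S!))
        (cong (λ l → l * (l ∸ 1) * (u * u ∸ 1)) |S|≡x)
      pairs-ST : ∑ S (λ i → ∑ T (g i)) ≡ x * (count t * (u ∸ 1))
      pairs-ST = trans
        (∑-All-const (All.map (λ i∈ → ∑-All-const (All.map (commonAnnihilators-dt i∈) T-dim)) S-dim))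
        (cong (_* (count t * (u ∸ 1))) |S|≡x)
      pairs-TT : 2 * ∑∑ T g ≡ 0
      pairs-TT = trans (∑∑-const (pairwise commonAnnihilators-tt T-dim T!))
        (ℕ.*-zeroʳ (length T * (length T ∸ 1)))
      pairs : 2 * ∑∑ (S ++ T) g ≡ x * (x ∸ 1) * (u * u ∸ 1) + 2 * (x * (count t * (u ∸ 1)))
      pairs = begin-equality
        2 * ∑∑ (S ++ T) g
          ≡⟨ cong (2 *_) (∑∑-++ S T g) ⟩
        2 * (∑∑ S g + ∑ S (λ i → ∑ T (g i)) + ∑∑ T g)
          ≡⟨ distrib₃ (∑∑ S g) (∑ S (λ i → ∑ T (g i))) (∑∑ T g) ⟩
        2 * ∑∑ S g + 2 * ∑ S (λ i → ∑ T (g i)) + 2 * ∑∑ T g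
          ≡⟨ cong₂ _+_ (cong₂ (λ a b → a + 2 * b) pairs-SS pairs-ST) pairs-TT ⟩
        x * (x ∸ 1) * (u * u ∸ 1) + 2 * (x * (count t * (u ∸ 1))) + 0
          ≡⟨ ℕ.+-identityʳ _ ⟩
        x * (x ∸ 1) * (u * u ∸ 1) + 2 * (x * (count t * (u ∸ 1))) ∎
        where
        distrib₃ : ∀ a b c → 2 * (a + b + c) ≡ 2 * a + 2 * b + 2 * c
        distrib₃ = solve-∀

-- The bound on a for each d and x.

theorem21 : ∀ {c ℓ : Level} (q t : ℕ) → IsPrimePower q → 2 ≤ t →
    (𝔽 : FiniteField c ℓ q) →
    (P : VectorSpace.Partition 𝔽 (2 * t)) →
    (a : ℤ) (m : ℕ → ℕ) →
    (∀ i → VectorSpace.Partition.dim P i ≤ t) →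
    ((+ VectorSpace.Partition.count P t) ≡ (+ (q ^ t + 1)) ℤ.- a) →
    (∀ d → 1 ≤ d → d + 1 ≤ t → VectorSpace.Partition.count P d ≡ m d) →
    ∀ d x → 1 ≤ d → d + 1 ≤ t → 1 ≤ x → x ≤ μ q t d (m d) →
    ((+ x / 1) ℚ.- R q t d x) ℚ.≤ (a / 1)
theorem21 q t _ _ 𝔽 P a m _ count-t count-d d x@(suc y) 1≤d d+1≤t 1≤x x≤μ =
  -- The denominator is positive because x lies below the cutoff `μ`.
  -divℕ-≤ (ℕ→ℚ x) _ (a / 1) (ℕ.m<n⇒0<n∸m xv<Q-1)
    -- The bound is proved in terms of v; this restores the powers of q occurring in `R`.
    (subst₂ (λ s r → ℕ→ℚ x ℚ.* ℕ→ℚ D ℚ.- ℕ→ℚ (x * y) ℚ.* (½ ℚ.* (ℕ→ℚ s ℚ.- 1ℚ) ℚ.+ 1ℚ ℚ.- ℕ→ℚ r)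
                       ℚ.≤ a / 1 ℚ.* ℕ→ℚ D)
      (trans (cong₂ _*_ u≡ u≡) (sym q^[2t-2d]≡u*u)) u≡
      (rational-bound {x} {x * y} {count t} {D} {v} a
        (trans count-t (cong (λ k → + k ℤ.- a) Q+1≡))
        (clear-denominator y (count t) D v bound)))
  where
  open VectorSpace.Partition P
  u = q ^ (t ∸ d)
  v = u ∸ 1
  -- D is the denominator of `R`. Writing q^t as `suc (D + x * v)` lets the truncated subtractions
  -- compute.
  D = q ^ t ∸ 1 ∸ x * v
  d<t : d < t
  d<t = ℕ.≤-trans (ℕ.≤-reflexive (ℕ.+-comm 1 d)) d+1≤t
  xv<Q-1 : x * v < q ^ t ∸ 1
  xv<Q-1 = ≤μ⇒< q t d (m d) 1≤x x≤μ
  suc[q^k∸1] : ∀ k → suc (q ^ k ∸ 1) ≡ q ^ k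
  suc[q^k∸1] k = ℕ.suc-pred (q ^ k) {{LinearAlgebra.q^n≢0 𝔽 k}}
  u≡ : suc v ≡ u
  u≡ = suc[q^k∸1] (t ∸ d)
  Q≡ : suc (D + x * v) ≡ q ^ t
  Q≡ = trans (cong suc (ℕ.m∸n+n≡m (ℕ.<⇒≤ xv<Q-1))) (suc[q^k∸1] t)
  Q+1≡ : q ^ t + 1 ≡ D + x * v + 2
  Q+1≡ = trans (cong (_+ 1) (sym Q≡)) (shift (D + x * v))
    where
    shift : ∀ k → suc k + 1 ≡ k + 2
    shift = solve-∀
  q^[2t-2d]≡u*u : q ^ (2 * t ∸ 2 * d) ≡ u * u
  q^[2t-2d]≡u*u = begin
    q ^ (2 * t ∸ 2 * d)          ≡⟨ cong (q ^_) (ℕ.*-distribˡ-∸ 2 t d) ⟨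
    q ^ (2 * (t ∸ d))            ≡⟨ cong (λ k → q ^ (t ∸ d + k)) (ℕ.+-identityʳ (t ∸ d)) ⟩
    q ^ (t ∸ d + (t ∸ d))        ≡⟨ ℕ.^-distribˡ-+-* q (t ∸ d) (t ∸ d) ⟩
    u * u                        ∎
    where open ≡-Reasoning
  x≤count-d : x ≤ count d
  x≤count-d = ℕ.≤-trans x≤μ (ℕ.≤-trans (μ≤ q t d (m d)) (ℕ.≤-reflexive (sym (count-d d 1≤d d+1≤t))))
  bound : let Q = suc (D + x * v) in
    2 * (x * (Q * suc v ∸ 1) + count t * (Q ∸ 1))
      ≤ 2 * (Q * Q ∸ 1) + (x * y * (suc v * suc v ∸ 1) + 2 * (x * (count t * (suc v ∸ 1))))
  bound = subst₂ (λ Q u → 2 * (x * (Q * u ∸ 1) + count t * (Q ∸ 1))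
      ≤ 2 * (Q * Q ∸ 1) + (x * y * (u * u ∸ 1) + 2 * (x * (count t * (u ∸ 1)))))
    (sym Q≡) (sym u≡) (LinearAlgebra.counting-inequality 𝔽 P d<t x≤count-d)
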